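{- Let $F$ be a digraph that is localized and colocalized. If $F$ cooperates, then $rK_1 + F$ cooperates for every integer $r \geq 0$.
   Context: All digraphs are finite, loopless, and between any two distinct vertices at most one of the two possible arcs is present. A digraph is $\mathcal{F}$-free if it has no induced subdigraph isomorphic to a member of $\mathcal{F}$. $\vec{\chi}(D)$ is the dichromatic number (least $k$ such that $V(D)$ partitions into $k$ sets inducing acyclic subdigraphs). $H$ is a hero in $\mathcal{F}$-free digraphs if there is $c$ with $\vec{\chi}(D)\le c$ for every $(\{H\}\cup\mathcal{F})$-free digraph $D$; more generally $H$ is a hero in a class $\mathcal{C}$ of digraphs if $H$-free members of $\mathcal{C}$ have bounded dichromatic number. $K_1$ is the one-vertex digraph, $D_1+D_2$ the disjoint union, $rD$ the disjoint union of $r$ copies of $D$ (with $0D$ empty, so $0K_1+F=F$). $D_1\Rightarrow D_2$ is obtained from $D_1+D_2$ by adding all arcs from $V(D_1)$ to $V(D_2)$; $\Delta(D_1,D_2,D_3)$ is obtained from $D_1+D_2+D_3$ by adding all arcs $d_id_j$, $d_i\in V(D_i)$, $d_j\in V(D_j)$, $(i,j)\in\{(1,2),(2,3),(3,1)\}$; $\Delta(1,1,H)$ means $\Delta(K_1,K_1,H)$. A digraph $D$ is $k$-local (resp. $k$-colocal) if for every vertex $v$ the subdigraph induced by the out-neighbourhood (resp. in-neighbourhood) of $v$ has dichromatic number at most $k$. A digraph $F$ cooperates if $H$ is a hero in $F$-free digraphs whenever (a) $H=K_1$, or (b) $H=H_1\Rightarrow H_2$ with $H_1,H_2$ heroes in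 $F$-free digraphs, or (c) $H=\Delta(1,1,H_1)$ with $H_1$ a hero in $F$-free digraphs. $F$ is localized (resp. colocalized) if for every $r\ge1$ and every digraph $H$ such that $\Delta(1,1,H)$ is a hero in $((r-1)K_1+F)$-free digraphs and $H$ is a hero in $(rK_1+F)$-free digraphs, it holds for every $k\ge1$ that $\Delta(1,1,H)$ is a hero in $k$-local (resp. $k$-colocal) $(rK_1+F)$-free digraphs. -}

module Defs where

open import Data.Nat using (ℕ; zero; suc; _+_; _≤_; _∸_)
open import Data.Fin using (Fin; zero; suc; splitAt; inject₁; fromℕ)
open import Data.Bool using (Bool; true; false)
open import Data.Sum using (_⊎_; inj₁; inj₂)
open import Data.Product using (Σ; ∃-syntax; _×_; _,_)
open import Data.Empty using (⊥)
open import Data.Unit using (⊤)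
open import Relation.Nullary using (¬_)
open import Relation.Binary.PropositionalEquality using (_≡_; refl)
open import Function.Definitions using (Injective)

record Digraph : Set where
  field
    size     : ℕ
    arc      : Fin size → Fin size → Bool
    loopless : ∀ v → arc v v ≡ false
    asym     : ∀ u v → arc u v ≡ true → arc v u ≡ false
open Digraph public

module _ {m n : ℕ} (a : Fin m → Fin m → Bool) (b : Fin n → Fin n → Bool)
         (R : Fin m → Fin n → Bool) (S : Fin n → Fin m → Bool) where
  arcSum : Fin m ⊎ Fin n → Fin m ⊎ Fin n → Bool
  arcSum (inj₁ u) (inj₁ u′) = a u u′
  arcSum (inj₁ u) (inj₂ w)  = R u w
  arcSum (inj₂ w) (inj₁ u)  = S w u
  arcSum (inj₂ w) (inj₂ w′) = b w w′

combine : (D E : Digraph)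
          (R : Fin (size D) → Fin (size E) → Bool)
          (S : Fin (size E) → Fin (size D) → Bool) →
          (∀ u w → R u w ≡ true → S w u ≡ false) →
          (∀ u w → S w u ≡ true → R u w ≡ false) →
          Digraph
combine D E R S p q = record
  { size     = size D + size E
  ; arc      = λ x y → arcSum (arc D) (arc E) R S (splitAt (size D) x) (splitAt (size D) y)
  ; loopless = λ v → ll (splitAt (size D) v)
  ; asym     = λ u v → as (splitAt (size D) u) (splitAt (size D) v)
  }
  where
  A = arcSum (arc D) (arc E) R S
  ll : ∀ s → A s s ≡ false
  ll (inj₁ u) = loopless D u
  ll (inj₂ w) = loopless E w
  as : ∀ s t → A s t ≡ true → A t s ≡ false
  as (inj₁ u) (inj₁ u′) h = asym D u u′ h
  as (inj₁ u) (inj₂ w)  h = p u w h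
  as (inj₂ w) (inj₁ u)  h = q u w h
  as (inj₂ w) (inj₂ w′) h = asym E w w′ h

∅D : Digraph
∅D = record { size = 0 ; arc = λ () ; loopless = λ () ; asym = λ () }

K₁ : Digraph
K₁ = record { size = 1 ; arc = λ _ _ → false ; loopless = λ _ → refl ; asym = λ _ _ () }

infixl 6 _+D_
infix 7 _·_
infixr 5 _⇒_

_+D_ : Digraph → Digraph → Digraph
D +D E = combine D E (λ _ _ → false) (λ _ _ → false) (λ _ _ ()) (λ _ _ ())

_·_ : ℕ → Digraph → Digraph
zero  · D = ∅D
suc r · D = D +D (r · D)

_⇒_ : Digraph → Digraph → Digraph
D ⇒ E = combine D E (λ _ _ → true) (λ _ _ → false) (λ _ _ _ → refl) (λ _ _ ())

-- Δ(D₁,D₂,D₃): arcs D₁→D₂, D₂→D₃, D₃→D₁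
private
  isFirst : ∀ {m n} → Fin m ⊎ Fin n → Bool
  isFirst (inj₁ _) = true
  isFirst (inj₂ _) = false

  isSecond : ∀ {m n} → Fin m ⊎ Fin n → Bool
  isSecond (inj₁ _) = false
  isSecond (inj₂ _) = true

  excl : ∀ {m n} (s : Fin m ⊎ Fin n) → isFirst s ≡ true → isSecond s ≡ false
  excl (inj₁ _) _ = refl

  excl′ : ∀ {m n} (s : Fin m ⊎ Fin n) → isSecond s ≡ true → isFirst s ≡ false
  excl′ (inj₂ _) _ = refl

Δ : Digraph → Digraph → Digraph → Digraph
Δ D₁ D₂ D₃ =
  combine D₁ (D₂ ⇒ D₃)
    (λ _ w → isFirst  (splitAt (size D₂) w))
    (λ w _ → isSecond (splitAt (size D₂) w))
    (λ _ w → excl  (splitAt (size D₂) w))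
    (λ _ w → excl′ (splitAt (size D₂) w))

Δ11 : Digraph → Digraph
Δ11 H = Δ K₁ K₁ H

Embeds : Digraph → Digraph → Set
Embeds H D =
  Σ (Fin (size H) → Fin (size D)) λ f →
    Injective _≡_ _≡_ f × (∀ u v → arc H u v ≡ arc D (f u) (f v))

Free : Digraph → Digraph → Set
Free H D = ¬ Embeds H D

DirectedCycleIn : (D : Digraph) → (Fin (size D) → Set) → Set
DirectedCycleIn D P =
  Σ ℕ λ k → Σ (Fin (suc k) → Fin (size D)) λ w →
    Injective _≡_ _≡_ w ×
    (∀ i → P (w i)) ×
    (∀ (i : Fin k) → arc D (w (inject₁ i)) (w (suc i)) ≡ true) ×
    (arc D (w (fromℕ k)) (w zero) ≡ true)

Acyclic : (D : Digraph) → (Fin (size D) → Set) → Set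
Acyclic D P = ¬ DirectedCycleIn D P

DichromOnLE : (D : Digraph) → (Fin (size D) → Set) → ℕ → Set
DichromOnLE D P c =
  Σ (Fin (size D) → Fin c) λ col →
    ∀ (j : Fin c) → Acyclic D (λ v → P v × col v ≡ j)

DichromLE : Digraph → ℕ → Set
DichromLE D c = DichromOnLE D (λ _ → ⊤) c

Local : ℕ → Digraph → Set
Local k D = ∀ v → DichromOnLE D (λ u → arc D v u ≡ true) k

Colocal : ℕ → Digraph → Set
Colocal k D = ∀ v → DichromOnLE D (λ u → arc D u v ≡ true) k

Class : Set₁
Class = Digraph → Set

HeroIn : Class → Digraph → Set
HeroIn C H = ∃[ c ] (∀ D → C D → Free H D → DichromLE D c)

HeroFree : Digraph → Digraph → Set
HeroFree F H = HeroIn (Free F) H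

Cooperates : Digraph → Set
Cooperates F =
  HeroFree F K₁ ×
  (∀ H₁ H₂ → HeroFree F H₁ → HeroFree F H₂ → HeroFree F (H₁ ⇒ H₂)) ×
  (∀ H₁ → HeroFree F H₁ → HeroFree F (Δ11 H₁))

Localized : Digraph → Set
Localized F =
  ∀ r → 1 ≤ r → ∀ H →
    HeroFree ((r ∸ 1) · K₁ +D F) (Δ11 H) →
    HeroFree (r · K₁ +D F) H →
    ∀ k → 1 ≤ k →
    HeroIn (λ D → Local k D × Free (r · K₁ +D F) D) (Δ11 H)

Colocalized : Digraph → Set
Colocalized F =
  ∀ r → 1 ≤ r → ∀ H →
    HeroFree ((r ∸ 1) · K₁ +D F) (Δ11 H) →
    HeroFree (r · K₁ +D F) H →
    ∀ k → 1 ≤ k →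
    HeroIn (λ D → Colocal k D × Free (r · K₁ +D F) D) (Δ11 H)

module Submission where

{-
Induct on r.  In an (r+1)K₁+F-free digraph the non-neighbours of a vertex induce an rK₁+F-free
digraph, so by induction they have bounded dichromatic number as soon as the target hero is absent.

For H₁ ⇒ H₂ the aim is a set M of bounded size and dichromatic number exceeding twice the bounds for
H₁ and H₂: then every vertex adjacent to all of M either receives arcs from a copy of H₁ in M or sends
arcs to a copy of H₂ in M, and the vertices of a fixed adjacency type induce an H₂-free or an H₁-free
digraph.  Such sets ("mountains") are built recursively: if many in-neighbours x of v have a large
set of common cyclic triangles with v, a mountain among them and one mountain in each of these sets
together need one more colour.  Otherwise, a vertex v whose in- and out-neighbourhoods are both large
yields a copy of H₁ in the former which is complete to most of the latter, hence a copy of H₁ ⇒ H₂;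
and if every vertex has a small out- (or in-) neighbourhood, then a single copy of H₂ (or H₁) already
bounds the dichromatic number.

For Δ(1,1,H), every arc lies in a small set of cyclic triangles.  Take a chain of bags, i.e. of sets
of large dichromatic number with few arcs from each bag back to its predecessor, and let the position
of a vertex be the number of bags it comes after.  Arcs decrease the position by at most 2, so colouring
by the position modulo 3 reduces the problem to a single level.  A level of large dichromatic number
contains, by the bounds for local and colocal digraphs, a vertex with large in- and out-neighbourhoods;
doing this twice gives three consecutive bags inside the level, which replace at most two old ones.
The chain would thus grow forever, but its length is at most about twice the number of vertices.
-}

open import Defs
open import Data.Bool using (Bool; true; false; _∧_; not)
import Data.Bool.Properties as Bool
open import Data.Empty using (⊥; ⊥-elim)
open import Data.Fin using (Fin; zero; suc; toℕ; fromℕ<; inject₁; inject≤; fromℕ; splitAt; join; _↑ˡ_; _↑ʳ_; _≟_; punchIn; punchOut)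
open import Data.Fin.Properties using (any?; all?; injective⇒≤; ↑ˡ-injective; ↑ʳ-injective; splitAt-↑ˡ; splitAt-↑ʳ; join-splitAt; inject≤-injective; punchIn-punchOut; suc-injective; toℕ-injective; toℕ<n; toℕ-fromℕ<)
open import Data.List using (List; []; _∷_; _++_; length; lookup; filter; allFin; drop)
open import Data.List.Membership.Propositional using () renaming (_∈_ to _∈ˡ_)
open import Data.List.Membership.Propositional.Properties using (∈-filter⁺; ∈-filter⁻; ∈-allFin; ∈-lookup; ∈-++⁺ˡ; ∈-++⁺ʳ; ∈-++⁻)
open import Data.List.Properties using (length-++)
open import Data.List.Relation.Unary.All as All using ()
open import Data.List.Relation.Unary.AllPairs using (_∷_)
open import Data.List.Relation.Unary.Any as Any using (here; there)
open import Data.List.Relation.Unary.Any.Properties using (lookup-index)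
open import Data.List.Relation.Unary.Unique.Propositional using (Unique)
open import Data.List.Relation.Unary.Unique.Propositional.Properties using (filter⁺; allFin⁺)
open import Data.Nat using (ℕ; zero; suc; _+_; _*_; _≤_; ⌊_/2⌋; z≤n; s≤s)
open import Data.Nat.Properties as ℕ using (anyUpTo?; ≤-refl; ≤-trans; m≤m+n; m≤n+m)
open import Data.Product using (Σ; ∃; _×_; _,_; proj₁; proj₂)
open import Data.Sum using (_⊎_; inj₁; inj₂; [_,_]′)
open import Data.Unit using (⊤; tt)
open import Data.Vec.Functional using () renaming (_∷_ to _◂_)
open import Function using (_∘_; id)
open import Function.Definitions using (Injective)
open import Relation.Binary.PropositionalEquality using (_≡_; _≢_; refl; sym; trans; cong; subst; subst₂)
open import Relation.Nullary using (¬_; Dec; yes; no; does; contradiction)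
open import Relation.Nullary.Decidable using (map′; _×-dec_; _→-dec_; ¬?; dec-true; decidable-stable)

-- Decidable subsets and search over finite functions

infix 4 _∈_ _⊆_
infixl 7 _∩_ _∖_

record _∈_ {A : Set} (v : A) (S : A → Bool) : Set where
  constructor mem
  field holds : S v ≡ true
open _∈_

_⊆_ : {A : Set} → (A → Bool) → (A → Bool) → Set
S ⊆ T = ∀ {v} → v ∈ S → v ∈ T

∧-true : ∀ {a b} → a ∧ b ≡ true → a ≡ true × b ≡ true
∧-true {true} {true} refl = refl , refl

-- Opacity lets Agda recover S and T from S ∩ T and S ∖ T.
opaque

  _∩_ _∖_ : {A : Set} → (A → Bool) → (A → Bool) → A → Bool
  (S ∩ T) v = S v ∧ T v
  (S ∖ T) v = S v ∧ not (T v)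

module _ {A : Set} {S T : A → Bool} {v : A} where

  opaque
    unfolding _∩_ _∖_

    ∩-intro : v ∈ S → v ∈ T → v ∈ S ∩ T
    ∩-intro (mem p) (mem q) = mem (trans (cong (_∧ T v) p) q)

    ∩-elim : v ∈ S ∩ T → v ∈ S × v ∈ T
    ∩-elim (mem p) = let a , b = ∧-true p in mem a , mem b

    ∩-left : v ∈ S ∩ T → v ∈ S
    ∩-left = proj₁ ∘ ∩-elim

    ∩-right : v ∈ S ∩ T → v ∈ T
    ∩-right = proj₂ ∘ ∩-elim

    ∖-intro : v ∈ S → ¬ v ∈ T → v ∈ S ∖ T
    ∖-intro (mem p) v∉T = mem (trans (cong (_∧ not (T v)) p) (cong not (Bool.¬-not (v∉T ∘ mem))))

    ∖-elim : v ∈ S ∖ T → v ∈ S × ¬ v ∈ T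
    ∖-elim (mem p) with ∧-true {S v} p
    ... | a , b = mem a , λ (mem q) → contradiction (trans (sym b) (cong not q)) λ ()

_∈?_ : {A : Set} (v : A) (S : A → Bool) → Dec (v ∈ S)
v ∈? S = map′ mem holds (S v Bool.≟ true)

∖-split : {A : Set} {S T : A → Bool} {v : A} → v ∈ S → v ∈ S ∖ T ⊎ v ∈ S ∩ T
∖-split {T = T} {v} p with v ∈? T
... | yes q = inj₂ (∩-intro p q)
... | no ¬q = inj₁ (∖-intro p ¬q)

opaque

  ⟦_⟧ : {A : Set} {P : A → Set} → (∀ v → Dec (P v)) → A → Bool
  ⟦ P? ⟧ v = does (P? v)

module _ {A : Set} {P : A → Set} (P? : ∀ v → Dec (P v)) where

  opaque
    unfolding ⟦_⟧

    ⟦⟧-intro : ∀ {v} → P v → v ∈ ⟦ P? ⟧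
    ⟦⟧-intro {v} p = mem (dec-true (P? v) p)

    ⟦⟧-elim : ∀ {v} → v ∈ ⟦ P? ⟧ → P v
    ⟦⟧-elim {v} (mem q) with P? v
    ... | yes p = p

-- The search assembles a function from its value at `zero` and its tail, which recovers a given
-- witness only pointwise; `resp` carries `P` across.
∃-function? : ∀ {m n} {P : (Fin m → Fin n) → Set} →
  (∀ {f g} → (∀ i → f i ≡ g i) → P f → P g) → (∀ f → Dec (P f)) → Dec (∃ P)
∃-function? {zero}  resp P? =
  map′ (_ ,_) (λ (f , p) → resp (λ ()) p) (P? λ ())
∃-function? {suc m} resp P? =
  map′ (λ (a , f , p) → (a ◂ f) , p)
       (λ (f , p) → f zero , f ∘ suc , resp (λ { zero → refl ; (suc i) → refl }) p)
       (any? λ a → ∃-function? (λ f≗g → resp λ { zero → refl ; (suc i) → f≗g i }) (λ f → P? (a ◂ f)))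

-- Colourings of vertex subsets

VSet : Digraph → Set
VSet D = Fin (size D) → Bool

record Colorable (D : Digraph) (S : VSet D) (c : ℕ) : Set where
  constructor coloring
  field dichrom : DichromOnLE D (λ v → v ∈ S) c
open Colorable

cycle-map : ∀ D {P Q : Fin (size D) → Set} →
  (∀ {v} → P v → Q v) → DirectedCycleIn D P → DirectedCycleIn D Q
cycle-map D P⇒Q (k , w , inj , m , step , close) = k , w , inj , (λ i → P⇒Q (m i)) , step , close

acyclic-mono : ∀ D (P Q : Fin (size D) → Set) → (∀ {v} → P v → Q v) → Acyclic D Q → Acyclic D P
acyclic-mono D P Q P⇒Q acyclic c = acyclic (cycle-map D {P} {Q} P⇒Q c)

module _ {D : Digraph} where

  private
    V : Set
    V = Fin (size D)

  cycle? : {P : V → Set} → (∀ v → Dec (P v)) → Dec (DirectedCycleIn D P)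
  cycle? {P} P? =
    -- An injective cycle has at most `size D` vertices, so finitely many lengths suffice.
    map′ (λ (k , _ , c) → k , c) (λ (k , c@(_ , r)) → k , injective⇒≤ (proj₁ r) , c)
      (anyUpTo? (λ k → ∃-function? resp λ w →
         injective? w
         ×-dec all? (λ i → P? (w i))
         ×-dec all? (λ i → arc D (w (inject₁ i)) (w (suc i)) Bool.≟ true)
         ×-dec (arc D (w (fromℕ k)) (w zero) Bool.≟ true)) (size D))
    where
    injective? : ∀ {m n} (f : Fin m → Fin n) → Dec (Injective _≡_ _≡_ f)
    injective? f = map′ (λ inj {x} {y} → inj x y) (λ inj x y → inj {x} {y})
      (all? λ x → all? λ y → (f x ≟ f y) →-dec (x ≟ y))

    IsCycle : ∀ k → (Fin (suc k) → V) → Set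
    IsCycle k w =
      Injective _≡_ _≡_ w × (∀ i → P (w i)) ×
      (∀ (i : Fin k) → arc D (w (inject₁ i)) (w (suc i)) ≡ true) × arc D (w (fromℕ k)) (w zero) ≡ true

    resp : ∀ {k} {f g : Fin (suc k) → V} → (∀ i → f i ≡ g i) → IsCycle k f → IsCycle k g
    resp f≗g (inj , m , step , close) =
      (λ {x} {y} eq → inj (trans (f≗g x) (trans eq (sym (f≗g y)))))
      , (λ i → subst P (f≗g i) (m i))
      , (λ i → subst₂ (λ a b → arc D a b ≡ true) (f≗g _) (f≗g _) (step i))
      , subst₂ (λ a b → arc D a b ≡ true) (f≗g _) (f≗g _) close

  Coloured : VSet D → ∀ {c} → (V → Fin c) → Fin c → V → Set
  Coloured S col j v = v ∈ S × col v ≡ j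

  opaque

    colorable? : ∀ S c → Dec (Colorable D S c)
    colorable? S c = map′ coloring dichrom (∃-function?
      (λ {f} {g} f≗g ok j → acyclic-mono D (Coloured S g j) (Coloured S f j)
        (λ {v} (p , eq) → p , trans (f≗g v) eq) (ok j))
      (λ col → all? λ j → ¬? (cycle? λ v → (v ∈? S) ×-dec (col v ≟ j))))

  mono : ∀ {S T c} → S ⊆ T → Colorable D T c → Colorable D S c
  mono {S} {T} S⊆T (coloring (col , ok)) = coloring (col , λ j →
    acyclic-mono D (Coloured S col j) (Coloured T col j) (λ (p , eq) → S⊆T p , eq) (ok j))

  -- The first vertex of a monochromatic cycle names an old colour, and injectivity of `inject≤`
  -- puts the whole cycle in that old class.
  weaken : ∀ {S a b} → a ≤ b → Colorable D S a → Colorable D S b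
  weaken {S} {a} {b} a≤b (coloring (col , ok)) = coloring (col′ , λ j cyc@(_ , w , _ , m , _) →
    acyclic-mono D (Coloured S col′ j) (Coloured S col (col (w zero)))
      (λ (p , eq) → p , inject≤-injective a≤b a≤b _ _ (trans eq (sym (proj₂ (m zero)))))
      (ok (col (w zero))) cyc)
    where
    col′ : V → Fin b
    col′ v = inject≤ (col v) a≤b

  cover : ∀ {S A B a b} → (∀ {v} → v ∈ S → v ∈ A ⊎ v ∈ B) →
    Colorable D A a → Colorable D B b → Colorable D S (a + b)
  cover {S} {A} {B} {a} {b} S⊆A∪B (coloring (f , f-ok)) (coloring (g , g-ok)) = coloring (col , λ j →
    subst (λ j → Acyclic D (Coloured S col j)) (join-splitAt a b j) (ok (splitAt a j)))
    where
    merge : ∀ {v} → Dec (v ∈ A) → Fin (a + b)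
    merge {v} (yes _) = f v ↑ˡ b
    merge {v} (no _)  = a ↑ʳ g v

    col : V → Fin (a + b)
    col v = merge (v ∈? A)

    left≢right : ∀ {i : Fin a} {j : Fin b} → i ↑ˡ b ≢ a ↑ʳ j
    left≢right {i} {j} eq
      with () ← trans (sym (splitAt-↑ˡ a i b)) (trans (cong (splitAt a) eq) (splitAt-↑ʳ a b j))

    on-left : ∀ {i v} → Coloured S col (i ↑ˡ b) v → Coloured A f i v
    on-left {v = v} (p , eq) with v ∈? A
    ... | yes q = q , ↑ˡ-injective b _ _ eq
    ... | no _  = ⊥-elim (left≢right (sym eq))

    on-right : ∀ {i v} → Coloured S col (a ↑ʳ i) v → Coloured B g i v
    on-right {v = v} (p , eq) with v ∈? A | S⊆A∪B p
    ... | yes _ | _      = ⊥-elim (left≢right eq)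
    ... | no ¬q | inj₁ q = contradiction q ¬q
    ... | no _  | inj₂ q = q , ↑ʳ-injective a _ _ eq

    ok : ∀ s → Acyclic D (Coloured S col (join a b s))
    ok (inj₁ i) = acyclic-mono D (Coloured S col (i ↑ˡ b)) (Coloured A f i) on-left (f-ok i)
    ok (inj₂ i) = acyclic-mono D (Coloured S col (a ↑ʳ i)) (Coloured B g i) on-right (g-ok i)

  colorable-∅ : ∀ {S c} → (∀ {v} → ¬ v ∈ S) → Colorable D S (suc c)
  colorable-∅ empty = coloring ((λ _ → zero) , λ _ (_ , w , _ , m , _) → empty (proj₁ (m zero)))

  -- The parts outside the `A j` are removed one after another at cost `a` each; what survives lies
  -- in every `A j` and costs `b` once.
  peel : ∀ {m a b} (A : Fin m → VSet D) S → (∀ j → Colorable D (S ∖ A j) a) →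
    (∀ T → T ⊆ S → (∀ j → T ⊆ A j) → Colorable D T b) → Colorable D S (m * a + b)
  peel {zero}  A S outside inside = inside S id (λ ())
  peel {suc m} {a} {b} A S outside inside =
    subst (Colorable D S) (sym (ℕ.+-assoc a (m * a) b))
      (cover ∖-split (outside zero)
        (peel (A ∘ suc) (S ∩ A zero)
          (λ j → mono (λ p → ∖-intro (∩-left (proj₁ (∖-elim p))) (proj₂ (∖-elim p))) (outside (suc j)))
          (λ T T⊆ T⊆A → inside T (∩-left ∘ T⊆) λ { zero → ∩-right ∘ T⊆ ; (suc j) → T⊆A j })))

  nondecreasing : ∀ {k} (f : Fin (suc k) → ℕ) → (∀ i → f (inject₁ i) ≤ f (suc i)) →
    ∀ i → f zero ≤ f i × f i ≤ f (fromℕ k)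
  nondecreasing {zero}  f step zero    = ≤-refl , ≤-refl
  nondecreasing {suc k} f step zero    =
    ≤-refl , ≤-trans (step zero) (proj₂ (nondecreasing (f ∘ suc) (step ∘ suc) zero))
  nondecreasing {suc k} f step (suc i) =
    let p , q = nondecreasing (f ∘ suc) (step ∘ suc) i in ≤-trans (step zero) p , q

  -- A cycle cannot leave a level of a function that is nondecreasing along arcs.
  levels : ∀ {S K} (ρ : V → ℕ) →
    (∀ {u v} → u ∈ S → v ∈ S → arc D u v ≡ true → ρ u ≤ ρ v) →
    (∀ i → Colorable D (S ∩ ⟦ (λ v → ρ v ℕ.≟ i) ⟧) K) → Colorable D S K
  levels {S} ρ up level =
    coloring ((λ v → proj₁ (dichrom (level (ρ v))) v) , λ j (k , w , inj , m , step , close) →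
      let nondec = nondecreasing (ρ ∘ w) (λ i → up (proj₁ (m _)) (proj₁ (m _)) (step i))
          flat : ∀ i → ρ (w i) ≡ ρ (w zero)
          flat i = ℕ.≤-antisym
            (≤-trans (proj₂ (nondec i)) (up (proj₁ (m _)) (proj₁ (m _)) close))
            (proj₁ (nondec i))
      in proj₂ (dichrom (level (ρ (w zero)))) j
           (k , w , inj
           , (λ i → ∩-intro (proj₁ (m i)) (⟦⟧-intro (λ v → ρ v ℕ.≟ ρ (w zero)) (flat i))
                  , trans (cong (λ l → proj₁ (dichrom (level l)) (w i)) (sym (flat i))) (proj₂ (m i)))
           , step , close))

-- Neighbourhoods and cyclic triangles

full : ∀ D → VSet D
full D _ = true

module _ (D : Digraph) where

  -- Non v contains v.
  Out In Non : Fin (size D) → VSet D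
  Out v u = arc D v u
  In v u = arc D u v
  Non v u = not (arc D v u) ∧ not (arc D u v)

  -- The vertices completing an arc u → v to a cyclic triangle.
  Return : Fin (size D) → Fin (size D) → VSet D
  Return u v = Out v ∩ In u

  trichotomy : ∀ v u → u ∈ Out v ⊎ u ∈ In v ⊎ u ∈ Non v
  trichotomy v u with u ∈? Out v | u ∈? In v
  ... | yes p | _     = inj₁ p
  ... | no _  | yes q = inj₂ (inj₁ q)
  ... | no ¬p | no ¬q = inj₂ (inj₂ (mem
    (trans (cong (λ b → not b ∧ not (arc D u v)) (Bool.¬-not (¬p ∘ mem))) (cong not (Bool.¬-not (¬q ∘ mem))))))

  Non-elim : ∀ {v u} → u ∈ Non v → arc D v u ≡ false × arc D u v ≡ false
  Non-elim (mem p) = let a , b = ∧-true p in Bool.not-injective a , Bool.not-injective b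

  antisym : ∀ {u v} → arc D u v ≡ true → ¬ arc D v u ≡ true
  antisym {u} {v} p q with () ← trans (sym q) (asym D u v p)

  arc⇒≢ : ∀ {u v} → arc D u v ≡ true → u ≢ v
  arc⇒≢ p refl = antisym p p

  triangle-cycle : ∀ {P : Fin (size D) → Set} {a b c} → P a → P b → P c →
    arc D a b ≡ true → arc D b c ≡ true → arc D c a ≡ true → DirectedCycleIn D P
  triangle-cycle {P} {a} {b} {c} pa pb pc ab bc ca = 2 , w , inj , vertices , step , ca
    where
    w : Fin 3 → Fin (size D)
    w zero = a
    w (suc zero) = b
    w (suc (suc zero)) = c

    inj : Injective _≡_ _≡_ w
    inj {zero} {zero} eq = refl
    inj {zero} {suc zero} eq = ⊥-elim (arc⇒≢ ab eq)
    inj {zero} {suc (suc zero)} eq = ⊥-elim (arc⇒≢ ca (sym eq))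
    inj {suc zero} {zero} eq = ⊥-elim (arc⇒≢ ab (sym eq))
    inj {suc zero} {suc zero} eq = refl
    inj {suc zero} {suc (suc zero)} eq = ⊥-elim (arc⇒≢ bc eq)
    inj {suc (suc zero)} {zero} eq = ⊥-elim (arc⇒≢ ca eq)
    inj {suc (suc zero)} {suc zero} eq = ⊥-elim (arc⇒≢ bc (sym eq))
    inj {suc (suc zero)} {suc (suc zero)} eq = refl

    vertices : ∀ i → P (w i)
    vertices zero = pa
    vertices (suc zero) = pb
    vertices (suc (suc zero)) = pc

    step : ∀ (i : Fin 2) → arc D (w (inject₁ i)) (w (suc i)) ≡ true
    step zero = ab
    step (suc zero) = bc

  colorable-singleton : ∀ v → Colorable D ⟦ _≟ v ⟧ 1
  colorable-singleton v = coloring ((λ _ → zero) , λ _ (_ , w , _ , m , _ , close) →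
    arc⇒≢ close (trans (⟦⟧-elim (_≟ v) (proj₁ (m _))) (sym (⟦⟧-elim (_≟ v) (proj₁ (m zero))))))

  -- By `none`, the vertices with small out-neighbourhood and those with small in-neighbourhood
  -- cover `S`, and smallness survives restriction to either part.
  local-colocal : ∀ {S p a b} →
    (∀ {T} → (∀ {v} → v ∈ T → Colorable D (T ∩ Out v) p) → Colorable D T a) →
    (∀ {T} → (∀ {v} → v ∈ T → Colorable D (T ∩ In v) p) → Colorable D T b) →
    (∀ {v} → v ∈ S → ¬ Colorable D (S ∩ Out v) p → ¬ Colorable D (S ∩ In v) p → ⊥) →
    Colorable D S (a + b)
  local-colocal {S} {p} local-bound colocal-bound none =
    cover sides (local-bound (restricted out?)) (colocal-bound (restricted in?))
    where
    out? : ∀ v → Dec (Colorable D (S ∩ Out v) p)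
    out? v = colorable? (S ∩ Out v) p

    in? : ∀ v → Dec (Colorable D (S ∩ In v) p)
    in? v = colorable? (S ∩ In v) p

    restricted : ∀ {N : Fin (size D) → VSet D} (P? : ∀ v → Dec (Colorable D (S ∩ N v) p)) →
      ∀ {v} → v ∈ S ∩ ⟦ P? ⟧ → Colorable D ((S ∩ ⟦ P? ⟧) ∩ N v) p
    restricted P? q = mono (λ r → ∩-intro (∩-left (∩-left r)) (∩-right r)) (⟦⟧-elim P? (∩-right q))

    sides : ∀ {v} → v ∈ S → v ∈ S ∩ ⟦ out? ⟧ ⊎ v ∈ S ∩ ⟦ in? ⟧
    sides {v} v∈S with out? v | in? v
    ... | yes q | _     = inj₁ (∩-intro v∈S (⟦⟧-intro out? q))
    ... | no _  | yes q = inj₂ (∩-intro v∈S (⟦⟧-intro in? q))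
    ... | no ¬o | no ¬i = ⊥-elim (none v∈S ¬o ¬i)

-- Induced subdigraphs

Embeds-trans : ∀ {A B C} → Embeds A B → Embeds B C → Embeds A C
Embeds-trans (f , f-inj , f-arc) (g , g-inj , g-arc) =
  g ∘ f , f-inj ∘ g-inj , λ u v → trans (f-arc u v) (g-arc (f u) (f v))

EmbedsIn : (H D : Digraph) → VSet D → Set
EmbedsIn H D S = Σ (Embeds H D) λ (f , _) → ∀ u → f u ∈ S

lookup-injective : {A : Set} {xs : List A} → Unique xs → Injective _≡_ _≡_ (lookup xs)
lookup-injective (x∉ ∷ u) {zero}  {zero}  eq = refl
lookup-injective (x∉ ∷ u) {zero}  {suc j} eq = contradiction eq (All.lookup x∉ (∈-lookup j))
lookup-injective (x∉ ∷ u) {suc i} {zero}  eq = contradiction (sym eq) (All.lookup x∉ (∈-lookup i))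
lookup-injective (x∉ ∷ u) {suc i} {suc j} eq = cong suc (lookup-injective u eq)

module Restrict (D : Digraph) (S : VSet D) where

  private
    members : List (Fin (size D))
    members = filter (_∈? S) (allFin (size D))

    emb : Fin (length members) → Fin (size D)
    emb = lookup members

    emb-inj : Injective _≡_ _≡_ emb
    emb-inj = lookup-injective (filter⁺ (_∈? S) (allFin⁺ (size D)))

    emb-∈ : ∀ i → emb i ∈ S
    emb-∈ i = proj₂ (∈-filter⁻ (_∈? S) {xs = allFin (size D)} (∈-lookup i))

    index : ∀ {v} → v ∈ S → Fin (length members)
    index {v} p = Any.index (∈-filter⁺ (_∈? S) (∈-allFin v) p)

    emb-index : ∀ {v} (p : v ∈ S) → emb (index p) ≡ v
    emb-index {v} p = sym (lookup-index (∈-filter⁺ (_∈? S) (∈-allFin v) p))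

  restrict : Digraph
  restrict = record
    { size     = length members
    ; arc      = λ i j → arc D (emb i) (emb j)
    ; loopless = λ i → loopless D (emb i)
    ; asym     = λ i j → asym D (emb i) (emb j)
    }

  embedsIn : ∀ {H} → Embeds H restrict → EmbedsIn H D S
  embedsIn (f , f-inj , f-arc) = (emb ∘ f , f-inj ∘ emb-inj , f-arc) , emb-∈ ∘ f

  restrict-free : ∀ {F} → Free F D → Free F restrict
  restrict-free {F} F-free e = F-free (proj₁ (embedsIn {F} e))

  private
    restrict-dichrom : ∀ {T Q c} → (∀ {i} → Q i → emb i ∈ T) →
      Colorable D T c → DichromOnLE restrict Q c
    restrict-dichrom Q⇒T (coloring (col , ok)) = col ∘ emb , λ j (k , w , inj , m , step , close) →
      ok j (k , emb ∘ w , inj ∘ emb-inj , (λ i → Q⇒T (proj₁ (m i)) , proj₂ (m i)) , step , close)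

  restrict-local : ∀ {p} → (∀ {v} → v ∈ S → Colorable D (S ∩ Out D v) p) → Local p restrict
  restrict-local local i =
    restrict-dichrom (λ {j} a → ∩-intro (emb-∈ j) (mem a)) (local (emb-∈ i))

  restrict-colocal : ∀ {p} → (∀ {v} → v ∈ S → Colorable D (S ∩ In D v) p) → Colocal p restrict
  restrict-colocal colocal i =
    restrict-dichrom (λ {j} a → ∩-intro (emb-∈ j) (mem a)) (colocal (emb-∈ i))

  -- The extra colour only serves the vertices outside S, which also have to be mapped somewhere.
  unrestrict : ∀ {c} → DichromLE restrict c → Colorable D S (suc c)
  unrestrict {c} (col , ok) = coloring (col′ , λ j (k , w , inj , m , step , close) →
      let p = λ i → proj₁ (m i)
          w′ = λ i → index (p i)
          emb-w′ : ∀ i → emb (w′ i) ≡ w i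
          emb-w′ i = emb-index (p i)
          arc-w′ : ∀ {i i′} → arc D (w i) (w i′) ≡ true → arc restrict (w′ i) (w′ i′) ≡ true
          arc-w′ {i} {i′} = subst₂ (λ a b → arc D a b ≡ true) (sym (emb-w′ i)) (sym (emb-w′ i′))
      in ok (col (w′ zero))
           (k , w′
           , (λ {x} {y} eq → inj (trans (sym (emb-w′ x)) (trans (cong emb eq) (emb-w′ y))))
           , (λ i → tt , suc-injective (trans (sym (col′-∈ (p i)))
                           (trans (proj₂ (m i)) (trans (sym (proj₂ (m zero))) (col′-∈ (p zero))))))
           , (λ i → arc-w′ (step i)) , arc-w′ close))
    where
    col′ : Fin (size D) → Fin (suc c)
    col′ v with v ∈? S
    ... | yes p = suc (col (index p))
    ... | no  _ = zero

    col′-∈ : ∀ {v} (p : v ∈ S) → col′ v ≡ suc (col (index p))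
    col′-∈ {v} p with v ∈? S
    ... | yes q = cong (suc ∘ col) (emb-inj (trans (emb-index q) (sym (emb-index p))))
    ... | no ¬p = contradiction p ¬p

  -- Heroes speak of whole digraphs, so the bound is taken in the subdigraph induced by `S` and
  -- pulled back; `suc` pays for the extra colour of `unrestrict`.
  hero-bound : ∀ {H C} → (hero : HeroIn C H) → C restrict → ¬ EmbedsIn H D S →
    Colorable D S (suc (proj₁ hero))
  hero-bound {H} (_ , bound) inC H-free = unrestrict (bound restrict inC λ e → H-free (embedsIn {H} e))

open Restrict public

⇒-embeds : ∀ {H₁ H₂} D (f : Embeds H₁ D) (g : Embeds H₂ D) →
  (∀ i j → arc D (proj₁ f i) (proj₁ g j) ≡ true) → Embeds (H₁ ⇒ H₂) D
⇒-embeds {H₁} {H₂} D (f , f-inj , f-arc) (g , g-inj , g-arc) f⇒g =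
  h ∘ splitAt m
  , (λ {x} {y} eq → trans (sym (join-splitAt m n x))
      (trans (cong (join m n) (h-inj (splitAt m x) (splitAt m y) eq)) (join-splitAt m n y)))
  , λ x y → h-arc (splitAt m x) (splitAt m y)
  where
  m = size H₁
  n = size H₂

  h : Fin m ⊎ Fin n → Fin (size D)
  h = [ f , g ]′

  h-inj : ∀ s t → h s ≡ h t → s ≡ t
  h-inj (inj₁ i) (inj₁ j) eq = cong inj₁ (f-inj eq)
  h-inj (inj₁ i) (inj₂ j) eq = contradiction eq (arc⇒≢ D (f⇒g i j))
  h-inj (inj₂ i) (inj₁ j) eq = contradiction (sym eq) (arc⇒≢ D (f⇒g j i))
  h-inj (inj₂ i) (inj₂ j) eq = cong inj₂ (g-inj eq)

  h-arc : ∀ s t →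
    arcSum (arc H₁) (arc H₂) (λ _ _ → true) (λ _ _ → false) s t ≡ arc D (h s) (h t)
  h-arc (inj₁ i) (inj₁ j) = f-arc i j
  h-arc (inj₁ i) (inj₂ j) = sym (f⇒g i j)
  h-arc (inj₂ i) (inj₁ j) = sym (asym D _ _ (f⇒g j i))
  h-arc (inj₂ i) (inj₂ j) = g-arc i j

-- Mountains

module Mountains {D : Digraph} where

  private
    V : Set
    V = Fin (size D)

  fromList : List V → VSet D
  fromList L = ⟦ (λ v → Any.any? (v ≟_) L) ⟧

  fromList-intro : ∀ {L v} → v ∈ˡ L → v ∈ fromList L
  fromList-intro {L} = ⟦⟧-intro (λ v → Any.any? (v ≟_) L)

  fromList-elim : ∀ {L v} → v ∈ fromList L → v ∈ˡ L
  fromList-elim {L} = ⟦⟧-elim (λ v → Any.any? (v ≟_) L)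

  -- Colorable D S 0 fails even for empty S, as the vertices outside S also need a colour.
  Exceeds : ℕ → VSet D → Set
  Exceeds zero    S = ∃ λ v → v ∈ S
  Exceeds (suc r) S = ¬ Colorable D S (suc r)

  -- Lists may repeat vertices, so lengths add exactly even when the pieces overlap.
  Mountain : ℕ → ℕ → VSet D → Set
  Mountain r N S =
    Σ (List V) λ L → length L ≡ N × (∀ {v} → v ∈ˡ L → v ∈ S) × Exceeds r (fromList L)

  -- Punching an avoided colour out of `Fin (suc r)` would leave a colouring of `S` with `r`
  -- colours.
  every-colour-occurs : ∀ {S} r → Exceeds r S → (col : V → Fin (suc r)) →
    (∀ k → Acyclic D (Coloured {D} S col k)) → ∀ j → ¬ (∀ {v} → v ∈ S → col v ≢ j)
  every-colour-occurs zero (v , v∈S) col ok j avoid with col v in eq | j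
  ... | zero | zero = avoid v∈S eq
  every-colour-occurs {S} (suc r) exceeds col ok j avoid = exceeds (coloring (col′ , λ k →
    acyclic-mono D (Coloured {D} S col′ k) (Coloured {D} S col (punchIn j k))
      (λ (p , eq) → p , trans (sym (col′-∈ p)) (cong (punchIn j) eq)) (ok (punchIn j k))))
    where
    remove : ∀ {k} → Dec (j ≡ k) → Fin (suc r)
    -- A dummy value: by `avoid`, this case only arises outside `S`.
    remove (yes _)  = zero
    remove (no j≢k) = punchOut j≢k

    col′ : V → Fin (suc r)
    col′ v = remove (j ≟ col v)

    col′-∈ : ∀ {v} → v ∈ S → punchIn j (col′ v) ≡ col v
    col′-∈ {v} p with j ≟ col v
    ... | yes eq = contradiction (sym eq) (avoid p)
    ... | no j≢  = punchIn-punchOut j≢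

  -- Each mountain exists only under a double negation; recursion along the list merges these
  -- finitely many double negations into one.
  gather : ∀ {r N S} (C : V → VSet D) (L : List V) →
    (∀ {x} → x ∈ˡ L → C x ⊆ S) → (∀ {x} → x ∈ˡ L → ¬ ¬ Mountain r N (C x)) →
    ¬ ¬ Σ (List V) λ L′ → length L′ ≡ length L * N × (∀ {y} → y ∈ˡ L′ → y ∈ S) ×
        (∀ {x} → x ∈ˡ L → Σ (Mountain r N (C x)) λ M → ∀ {y} → y ∈ˡ proj₁ M → y ∈ˡ L′)
  gather C []      C⊆S mountains k = k ([] , refl , (λ ()) , λ ())
  gather C (x ∷ L) C⊆S mountains k =
    mountains (here refl) λ where
      m@(M , size-M , M⊆ , _) → gather C L (C⊆S ∘ there) (mountains ∘ there) λ where
        (L′ , size-L′ , L′⊆S , covers) → k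
          ( M ++ L′
          , trans (length-++ M) (trans (cong (_+ length L′) size-M) (cong (_ +_) size-L′))
          , (λ p → [ C⊆S (here refl) ∘ M⊆ , L′⊆S ]′ (∈-++⁻ M p))
          , λ { (here refl) → m , ∈-++⁺ˡ
              ; (there p)   → let m′ , M′⊆ = covers p in m′ , ∈-++⁺ʳ M ∘ M′⊆ })

  -- In a colouring of the enlarged set with suc r colours, the colour of v occurs at some x in X
  -- and again at some y in C x, closing the monochromatic triangle x → v → y → x.
  suspend : ∀ {r N b S} → (∀ T → ¬ Colorable D T b → ¬ ¬ Mountain r N T) →
    ∀ {v} → v ∈ S → (X : VSet D) (C : V → VSet D) → X ⊆ S ∩ In D v →
    (∀ {x} → x ∈ X → C x ⊆ S ∩ Return D x v × ¬ Colorable D (C x) b) →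
    ¬ Colorable D X b → ¬ ¬ Mountain (suc r) (suc (N + N * N)) S
  suspend {r} {N} {b} {S} climb {v} v∈S X C X⊆ C-spec X-big k =
    climb X X-big λ (L , size-L , L⊆X , L-exceeds) →
    gather C L (λ x∈ → ∩-left ∘ proj₁ (C-spec (L⊆X x∈)))
      (λ x∈ → climb (C _) (proj₂ (C-spec (L⊆X x∈)))) λ (L′ , size-L′ , L′⊆S , covers) →
    k ( v ∷ L ++ L′
      , cong suc (trans (length-++ L)
          (trans (cong (length L +_) size-L′) (cong (λ l → l + l * N) size-L)))
      , (λ { (here refl) → v∈S
           ; (there p)   → [ ∩-left ∘ X⊆ ∘ L⊆X , L′⊆S ]′ (∈-++⁻ L p) })
      , λ (coloring (col , ok)) →
        let M = fromList (v ∷ L ++ L′)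
            on : ∀ L₀ → (∀ {y} → y ∈ˡ L₀ → y ∈ˡ v ∷ L ++ L′) →
                 ∀ j → Acyclic D (Coloured {D} (fromList L₀) col j)
            on L₀ L₀⊆ j = acyclic-mono D (Coloured {D} (fromList L₀) col j) (Coloured {D} M col j)
              (λ (p , eq) → fromList-intro (L₀⊆ (fromList-elim p)) , eq) (ok j)
        in every-colour-occurs r L-exceeds col (on L (there ∘ ∈-++⁺ˡ)) (col v) λ x∈ col-x →
           let x∈L = fromList-elim x∈
               (L″ , _ , L″⊆C , L″-exceeds) , L″⊆L′ = covers x∈L
               L″⊆ = λ {y} → there ∘ ∈-++⁺ʳ L ∘ L″⊆L′ {y}
           in every-colour-occurs r L″-exceeds col (on L″ L″⊆) (col v) λ y∈ col-y →
              let y∈L″ = fromList-elim y∈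
                  y∈Return = ∩-right (proj₁ (C-spec (L⊆X x∈L)) (L″⊆C y∈L″))
              in ok (col v) (triangle-cycle D {Coloured {D} M col (col v)}
                   (fromList-intro (there (∈-++⁺ˡ x∈L)) , col-x)
                   (fromList-intro (here refl) , refl)
                   (fromList-intro (L″⊆ y∈L″) , col-y)
                   (holds (∩-right (X⊆ (L⊆X x∈L))))
                   (holds (∩-left y∈Return)) (holds (∩-right y∈Return))) )

module Neighbourhoods {D : Digraph} {c : ℕ} (non-bound : ∀ v → Colorable D (Non D v) c) where

  outside-Out : ∀ {S a} v → Colorable D (S ∩ In D v) a → Colorable D (S ∖ Out D v) (a + c)
  outside-Out v in-bound = cover (λ p → let v∈S , v∉Out = ∖-elim p in
      [ (λ q → contradiction q v∉Out) , [ inj₁ ∘ ∩-intro v∈S , inj₂ ]′ ]′ (trichotomy D v _))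
    in-bound (non-bound v)

  outside-In : ∀ {S a} v → Colorable D (S ∩ Out D v) a → Colorable D (S ∖ In D v) (a + c)
  outside-In v out-bound = cover (λ p → let v∈S , v∉In = ∖-elim p in
      [ inj₁ ∘ ∩-intro v∈S , [ (λ q → contradiction q v∉In) , inj₂ ]′ ]′ (trichotomy D v _))
    out-bound (non-bound v)

  around : ∀ {S a b} v → Colorable D (S ∩ In D v) a → Colorable D (S ∩ Out D v) b →
    Colorable D S ((a + c) + b)
  around v in-bound out-bound = cover ∖-split (outside-Out v in-bound) out-bound

-- The hero H₁ ⇒ H₂

module JoinBounds (m₁ m₂ c h : ℕ) where

  -- In `one-sided` the first summand pays for the in-neighbours of a vertex, heavy and light, and
  -- the second for its out-neighbours, through `out-peel`.
  degree : ℕ → ℕ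
  degree b = (b + h) + (m₁ * (b + c) + h)

  -- The two summands of `threshold (suc r)` come from `local-bound` and `colocal-bound`. A
  -- suspended mountain consists of its apex, a mountain of `N` in-neighbours, and `N` further
  -- mountains of size `N`.
  threshold mountain-size : ℕ → ℕ
  threshold zero    = 1
  threshold (suc r) = let p = degree (threshold r) in (m₂ * (p + c) + h) + (m₁ * (p + c) + h)
  mountain-size zero    = 1
  mountain-size (suc r) = let N = mountain-size r in suc (N + N * N)

  by-adjacency : ℕ → ℕ
  by-adjacency zero    = h
  by-adjacency (suc N) = (by-adjacency N + c) + by-adjacency N

  bound : ℕ
  bound = let r = suc (h + h) in threshold r + by-adjacency (mountain-size r)

module Join {D H₁ H₂ : Digraph} {c h : ℕ}
  (non-bound : ∀ v → Colorable D (Non D v) c)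
  (hero₁ : ∀ S → ¬ EmbedsIn H₁ D S → Colorable D S h)
  (hero₂ : ∀ S → ¬ EmbedsIn H₂ D S → Colorable D S h)
  (⇒-free : Free (H₁ ⇒ H₂) D) where

  open Mountains {D}
  open Neighbourhoods non-bound

  private
    m₁ = size H₁
    m₂ = size H₂

  open JoinBounds m₁ m₂ c h

  -- A copy of `H₂` inside the common out-neighbourhood of the copy `f` of `H₁` would complete it to
  -- `H₁ ⇒ H₂`, so `hero₂` bounds what survives the peeling.
  out-peel : (f : Embeds H₁ D) → ∀ {S a} → (∀ j → Colorable D (S ∩ In D (proj₁ f j)) a) →
    Colorable D S (m₁ * (a + c) + h)
  out-peel f {S} in-bound = peel (λ j → Out D (proj₁ f j)) S
    (λ j → outside-Out (proj₁ f j) (in-bound j))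
    (λ T _ T⊆Out → hero₂ T λ (g , g∈T) → ⇒-free (⇒-embeds {H₁} {H₂} D f g λ i j → holds (T⊆Out i (g∈T j))))

  in-peel : (g : Embeds H₂ D) → ∀ {S a} → (∀ j → Colorable D (S ∩ Out D (proj₁ g j)) a) →
    Colorable D S (m₂ * (a + c) + h)
  in-peel g {S} out-bound = peel (λ j → In D (proj₁ g j)) S
    (λ j → outside-In (proj₁ g j) (out-bound j))
    (λ T _ T⊆In → hero₁ T λ (f , f∈T) → ⇒-free (⇒-embeds {H₁} {H₂} D f g λ i j → holds (T⊆In j (f∈T i))))

  -- Either `S` contains no copy of `H₂` and `hero₂` applies, or a copy in `S` can be peeled with
  -- its small out-neighbourhoods. Stability of the decidable goal replaces the case distinction.
  local-bound : ∀ {S p} → (∀ {v} → v ∈ S → Colorable D (S ∩ Out D v) p) →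
    Colorable D S (m₂ * (p + c) + h)
  local-bound {S} local = decidable-stable (colorable? S _) λ ¬col →
    ¬col (weaken (m≤n+m h _) (hero₂ S λ (g , g∈S) → ¬col (in-peel g (local ∘ g∈S))))

  colocal-bound : ∀ {S p} → (∀ {v} → v ∈ S → Colorable D (S ∩ In D v) p) →
    Colorable D S (m₁ * (p + c) + h)
  colocal-bound {S} colocal = decidable-stable (colorable? S _) λ ¬col →
    ¬col (weaken (m≤n+m h _) (hero₁ S λ (f , f∈S) → ¬col (out-peel f (colocal ∘ f∈S))))

  -- Light in-neighbours of v dominate almost all of Out v, so a copy of H₁ among them leaves no
  -- room for a large Out v.  Heavy in-neighbours of v are few, as otherwise v suspends a mountain.
  one-sided : ∀ {S b v} →
    (∀ (X : VSet D) (C : Fin (size D) → VSet D) → X ⊆ S ∩ In D v →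
      (∀ {x} → x ∈ X → C x ⊆ S ∩ Return D x v × ¬ Colorable D (C x) b) → Colorable D X b) →
    ¬ Colorable D (S ∩ In D v) (degree b) → ¬ Colorable D (S ∩ Out D v) (degree b) → ⊥
  one-sided {S} {b} {v} few-heavy in-big out-big =
    in-big (weaken (m≤m+n (b + h) _) (cover ∖-split (few-heavy (S ∩ In D v ∖ Light) (λ x → S ∩ Return D x v)
      (proj₁ ∘ ∖-elim) (λ p → id , proj₂ (∖-elim p) ∘ ⟦⟧-intro light?)) light-bound))
    where
    light? : ∀ x → Dec (Colorable D (S ∩ Return D x v) b)
    light? x = colorable? (S ∩ Return D x v) b

    Light : VSet D
    Light = ⟦ light? ⟧

    light-bound : Colorable D (S ∩ In D v ∩ Light) h
    light-bound = hero₁ _ λ (f , f∈) → out-big (weaken (m≤n+m _ (b + h)) (out-peel f λ j →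
      mono (λ p → let q = ∩-left p in ∩-intro (∩-left q) (∩-intro (∩-right q) (∩-right p)))
           (⟦⟧-elim light? (∩-right (f∈ j)))))

  -- If no mountain exists, `suspend` makes the heavy in-neighbours few at every vertex; then
  -- `one-sided` leaves no vertex with both neighbourhoods large, and `local-colocal` colours `S`.
  climb : ∀ r S → ¬ Colorable D S (threshold r) → ¬ ¬ Mountain r (mountain-size r) S
  climb zero    S big no-mountain = big (colorable-∅ λ {v} v∈S → no-mountain
    (v ∷ [] , refl , (λ { (here refl) → v∈S }) , v , fromList-intro (here refl)))
  climb (suc r) S big no-mountain = big (local-colocal D local-bound colocal-bound λ v∈S out-big in-big →
    one-sided (λ X C X⊆ C-spec → decidable-stable (colorable? X _) λ X-big →
      suspend (climb r) v∈S X C X⊆ C-spec X-big no-mountain) in-big out-big)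

  -- S is split according to the adjacencies of its vertices to the mountain M; a part that is
  -- complete from A and complete to B, where M = A ∪ B, cannot meet both heroes.
  adjacency-bound : ∀ {M} L A B S → (∀ {a s} → a ∈ˡ A → s ∈ S → arc D a s ≡ true) →
    (∀ {b s} → b ∈ˡ B → s ∈ S → arc D s b ≡ true) →
    (∀ {v} → v ∈ M → v ∈ˡ L ⊎ v ∈ˡ A ⊎ v ∈ˡ B) → ¬ Colorable D M (h + h) →
    Colorable D S (by-adjacency (length L))
  adjacency-bound [] A B S A⇒S S⇒B M⊆ M-big = decidable-stable (colorable? S h) λ S-big →
    M-big (cover (λ p → [ (λ ()) , [ inj₁ ∘ fromList-intro , inj₂ ∘ fromList-intro ]′ ]′ (M⊆ p))
      (hero₁ (fromList A) λ (f , f∈A) → S-big (hero₂ S λ (g , g∈S) →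
        ⇒-free (⇒-embeds {H₁} {H₂} D f g λ i j → A⇒S (fromList-elim (f∈A i)) (g∈S j))))
      (hero₂ (fromList B) λ (g , g∈B) → S-big (hero₁ S λ (f , f∈S) →
        ⇒-free (⇒-embeds {H₁} {H₂} D f g λ i j → S⇒B (fromList-elim (g∈B j)) (f∈S i)))))
  adjacency-bound (x ∷ L) A B S A⇒S S⇒B M⊆ M-big = around x
    (adjacency-bound L A (x ∷ B) (S ∩ In D x)
        (λ a∈A → A⇒S a∈A ∘ ∩-left)
        (λ { (here refl) p → holds (∩-right {S = S} {T = In D x} p) ; (there b∈B) p → S⇒B b∈B (∩-left p) })
        (λ p → [ (λ { (here refl) → inj₂ (inj₂ (here refl)) ; (there q) → inj₁ q })
               , inj₂ ∘ [ inj₁ , inj₂ ∘ there ]′ ]′ (M⊆ p)) M-big)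
    (adjacency-bound L (x ∷ A) B (S ∩ Out D x)
      (λ { (here refl) p → holds (∩-right {S = S} {T = Out D x} p) ; (there a∈A) p → A⇒S a∈A (∩-left p) })
      (λ b∈B → S⇒B b∈B ∘ ∩-left)
      (λ p → [ (λ { (here refl) → inj₂ (inj₁ (here refl)) ; (there q) → inj₁ q })
             , inj₂ ∘ [ inj₁ ∘ there , inj₂ ]′ ]′ (M⊆ p)) M-big)

  full-bound : Colorable D (full D) bound
  full-bound = decidable-stable (colorable? (full D) bound) λ big →
    climb r (full D) (big ∘ weaken (m≤m+n _ _)) λ (L , size-L , _ , L-big) →
      big (weaken (m≤n+m _ (threshold r))
        (subst (λ N → Colorable D (full D) (by-adjacency N)) size-L
          (adjacency-bound L [] [] (full D) (λ ()) (λ ()) (inj₁ ∘ fromList-elim) (L-big ∘ weaken (ℕ.n≤1+n _)))))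
    where
    -- With `h` a variable, the successor lets `Exceeds r` reduce to its second clause.
    r = suc (h + h)

-- The hero Δ(1,1,H)

Δ11-embeds : ∀ {H} D {u v} → arc D u v ≡ true → EmbedsIn H D (Return D u v) → Embeds (Δ11 H) D
Δ11-embeds {H} D {u} {v} u→v ((f , f-inj , f-arc) , f∈) =
  g , (λ {x} {y} → g-inj x y) , g-arc
  where
  v→ : ∀ i → arc D v (f i) ≡ true
  v→ i = holds (∩-left (f∈ i))

  →u : ∀ i → arc D (f i) u ≡ true
  →u i = holds (∩-right (f∈ i))

  g : Fin (suc (suc (size H))) → Fin (size D)
  g zero = u
  g (suc zero) = v
  g (suc (suc i)) = f i

  g-inj : ∀ x y → g x ≡ g y → x ≡ y
  g-inj zero zero eq = refl
  g-inj zero (suc zero) eq = contradiction eq (arc⇒≢ D u→v)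
  g-inj zero (suc (suc j)) eq = contradiction (sym eq) (arc⇒≢ D (→u j))
  g-inj (suc zero) zero eq = contradiction (sym eq) (arc⇒≢ D u→v)
  g-inj (suc zero) (suc zero) eq = refl
  g-inj (suc zero) (suc (suc j)) eq = contradiction eq (arc⇒≢ D (v→ j))
  g-inj (suc (suc i)) zero eq = contradiction eq (arc⇒≢ D (→u i))
  g-inj (suc (suc i)) (suc zero) eq = contradiction (sym eq) (arc⇒≢ D (v→ i))
  g-inj (suc (suc i)) (suc (suc j)) eq = cong (λ k → suc (suc k)) (f-inj eq)

  g-arc : ∀ x y → arc (Δ11 H) x y ≡ arc D (g x) (g y)
  g-arc zero zero = sym (loopless D u)
  g-arc zero (suc zero) = sym u→v
  g-arc zero (suc (suc j)) = sym (asym D _ _ (→u j))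
  g-arc (suc zero) zero = sym (asym D _ _ u→v)
  g-arc (suc zero) (suc zero) = sym (loopless D v)
  g-arc (suc zero) (suc (suc j)) = sym (v→ j)
  g-arc (suc (suc i)) zero = sym (→u i)
  g-arc (suc (suc i)) (suc zero) = sym (asym D _ _ (v→ i))
  g-arc (suc (suc i)) (suc (suc j)) = f-arc i j

-- Embeddings involving isolated vertices

K₁-embeds : ∀ D → Fin (size D) → Embeds K₁ D
K₁-embeds D v = (λ _ → v) , (λ { {zero} {zero} _ → refl }) , λ _ _ → sym (loopless D v)

module _ (F : Digraph) (r : ℕ) where

  private
    smaller larger : Digraph
    smaller = r · K₁ +D F
    larger  = suc r · K₁ +D F

    arc-suc : ∀ x y → arc larger (suc x) (suc y) ≡ arc smaller x y
    arc-suc x y with splitAt (size (r · K₁)) x | splitAt (size (r · K₁)) y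
    ... | inj₁ _ | inj₁ _ = refl
    ... | inj₁ _ | inj₂ _ = refl
    ... | inj₂ _ | inj₁ _ = refl
    ... | inj₂ _ | inj₂ _ = refl

    arc-zeroˡ : ∀ y → arc larger zero (suc y) ≡ false
    arc-zeroˡ y with splitAt (size (r · K₁)) y
    ... | inj₁ _ = refl
    ... | inj₂ _ = refl

    arc-zeroʳ : ∀ x → arc larger (suc x) zero ≡ false
    arc-zeroʳ x with splitAt (size (r · K₁)) x
    ... | inj₁ _ = refl
    ... | inj₂ _ = refl

  drop-K₁ : Embeds smaller larger
  drop-K₁ = suc , (λ { refl → refl }) , λ x y → sym (arc-suc x y)

  -- The vertex `v`, itself a member of `Non D v`, is removed so that it can serve as the new
  -- isolated vertex.
  add-K₁ : ∀ D v → EmbedsIn smaller D (Non D v ∖ ⟦ _≟ v ⟧) → Embeds larger D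
  add-K₁ D v ((f , f-inj , f-arc) , f∈) = g , (λ {x} {y} → g-inj x y) , g-arc
    where
    f≢v : ∀ i → f i ≢ v
    f≢v i eq = proj₂ (∖-elim (f∈ i)) (⟦⟧-intro (_≟ v) eq)

    v-f : ∀ i → arc D v (f i) ≡ false × arc D (f i) v ≡ false
    v-f i = Non-elim D (proj₁ (∖-elim (f∈ i)))

    g : Fin (suc (size smaller)) → Fin (size D)
    g zero = v
    g (suc i) = f i

    g-inj : ∀ x y → g x ≡ g y → x ≡ y
    g-inj zero zero eq = refl
    g-inj zero (suc j) eq = contradiction (sym eq) (f≢v j)
    g-inj (suc i) zero eq = contradiction eq (f≢v i)
    g-inj (suc i) (suc j) eq = cong suc (f-inj eq)

    g-arc : ∀ x y → arc larger x y ≡ arc D (g x) (g y)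
    g-arc zero zero = sym (loopless D v)
    g-arc zero (suc j) = trans (arc-zeroˡ j) (sym (proj₁ (v-f j)))
    g-arc (suc i) zero = trans (arc-zeroʳ i) (sym (proj₂ (v-f i)))
    g-arc (suc i) (suc j) = trans (arc-suc i j) (f-arc i j)

nonempty : ∀ {D S c} → ¬ Colorable D S (suc c) → ∃ λ v → v ∈ S
nonempty {S = S} big with any? (_∈? S)
... | yes p = p
... | no ¬p = contradiction (colorable-∅ λ p → ¬p (_ , p)) big

-- Residues modulo three

residue : ℕ → Fin 3
residue zero                = zero
residue (suc zero)          = suc zero
residue (suc (suc zero))    = suc (suc zero)
residue (suc (suc (suc n))) = residue n

-- Only `n + 1` and `n + 2` have to be excluded, and both differ from `n` modulo three.
residue-gap : ∀ m n → m ≤ n + 2 → residue m ≡ residue n → m ≤ n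
residue-gap zero n m≤ eq = z≤n
residue-gap (suc zero) (suc n) m≤ eq = s≤s z≤n
residue-gap (suc (suc zero)) (suc (suc n)) m≤ eq = s≤s (s≤s z≤n)
residue-gap (suc (suc zero)) (suc zero) m≤ ()
residue-gap (suc (suc (suc m))) zero (s≤s (s≤s ())) eq
residue-gap (suc (suc (suc zero))) (suc zero) m≤ ()
residue-gap (suc (suc (suc (suc m)))) (suc zero) (s≤s (s≤s (s≤s ()))) eq
residue-gap (suc (suc (suc zero))) (suc (suc zero)) m≤ ()
residue-gap (suc (suc (suc (suc zero)))) (suc (suc zero)) m≤ ()
residue-gap (suc (suc (suc (suc (suc m))))) (suc (suc zero)) (s≤s (s≤s (s≤s (s≤s ())))) eq
residue-gap (suc (suc (suc m))) (suc (suc (suc n))) (s≤s (s≤s (s≤s m≤))) eq =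
  s≤s (s≤s (s≤s (residue-gap m n m≤ eq)))

module ChainBounds (c h : ℕ) (local-χ colocal-χ : ℕ → ℕ) where

  -- Both are totals of `around`: `lean` from two neighbourhoods of cost `suc h`, `large` from two
  -- of cost `lean`.
  lean large : ℕ
  lean  = (suc h + c) + suc h
  large = (lean + c) + lean

  split : ℕ → ℕ
  split p = local-χ p + colocal-χ p

  -- The inner `large` yields the first bag of a refinement and the inner `split large` the other
  -- two; `bound` adds up three residue classes.
  level-bound bound : ℕ
  level-bound = split (large + split large)
  bound = (level-bound + level-bound) + level-bound

-- Chains of bags

module Chains {D : Digraph} {c h : ℕ} {local-χ colocal-χ : ℕ → ℕ}
  (non-bound : ∀ v → Colorable D (Non D v) c)
  (return-bound : ∀ {u v} → arc D u v ≡ true → Colorable D (Return D u v) (suc h))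
  (local-bound : ∀ {S p} → (∀ {v} → v ∈ S → Colorable D (S ∩ Out D v) p) → Colorable D S (local-χ p))
  (colocal-bound : ∀ {S p} → (∀ {v} → v ∈ S → Colorable D (S ∩ In D v) p) → Colorable D S (colocal-χ p))
  where

  open ChainBounds c h local-χ colocal-χ
  open Neighbourhoods non-bound

  private
    V : Set
    V = Fin (size D)

  Bag : VSet D → Set
  Bag B = ¬ Colorable D B large

  -- Backward arcs, from `B` to `A`, are limited at both of their ends.
  Precedes : VSet D → VSet D → Set
  Precedes A B =
    (∀ {x} → x ∈ A → Colorable D (B ∩ In D x) (suc h)) ×
    (∀ {x} → x ∈ B → Colorable D (A ∩ Out D x) (suc h))

  -- For a bag `B` this forces many in-neighbours of `v` in `B`, see `bag-not-after`.
  After : VSet D → V → Set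
  After B v = Colorable D (B ∩ Out D v) lean

  after? : ∀ B v → Dec (After B v)
  after? B v = colorable? (B ∩ Out D v) lean

  -- A backward arc from `b` to `a` closes the cyclic triangle a → v → b → a, so its ends lie in
  -- sets bounded by `return-bound`.
  precedes-via : ∀ {A B v} → A ⊆ In D v → B ⊆ Out D v → Precedes A B
  precedes-via A⊆ B⊆ =
    (λ x∈A → mono (λ p → ∩-intro (B⊆ (∩-left p)) (∩-right p)) (return-bound (holds (A⊆ x∈A)))) ,
    (λ x∈B → mono (λ p → ∩-intro (∩-right p) (A⊆ (∩-left p))) (return-bound (holds (B⊆ x∈B))))

  precedes-complete : ∀ {A B} → (∀ {a b} → a ∈ A → b ∈ B → ¬ b ∈ In D a) → Precedes A B
  precedes-complete no-back =
    (λ x∈A → colorable-∅ λ p → no-back x∈A (∩-left p) (∩-right p)) ,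
    (λ x∈B → colorable-∅ λ p → no-back (∩-left p) x∈B (mem (holds (∩-right p))))

  bag-not-after : ∀ {B v} → Bag B → Colorable D (B ∩ In D v) lean → ¬ After B v
  bag-not-after {v = v} bag before after = bag (around v before after)

  -- Given b → v, the out-neighbours of `v` in `A` split around `b`: those entering `b` close
  -- triangles with b → v, and those leaving `b` are ends of backward arcs. Their total is `lean`,
  -- so `v` would be after `A`.
  no-in : ∀ {A B v b} → Precedes A B → ¬ After A v → b ∈ B → ¬ b ∈ In D v
  no-in {b = b} (_ , back) ¬after b∈B b→v = ¬after (around b
    (mono (λ p → ∩-intro (∩-right (∩-left p)) (∩-right p)) (return-bound (holds b→v)))
    (mono (λ p → ∩-intro (∩-left (∩-left p)) (∩-right p)) (back b∈B)))

  -- Dually, an arc v → a would make the in-neighbours of `v` in `B` few as well, which is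
  -- impossible for a bag.
  no-out : ∀ {A B v a} → Precedes A B → Bag B → After B v → a ∈ A → ¬ a ∈ Out D v
  no-out {a = a} (back , _) bag after a∈A v→a = bag-not-after bag (around a
    (mono (λ p → ∩-intro (∩-left (∩-left p)) (∩-right p)) (back a∈A))
    (mono (λ p → ∩-intro (∩-right p) (∩-right (∩-left p))) (return-bound (holds v→a)))) after

  after-previous : ∀ {A B v} → Precedes A B → Bag B → After B v → After A v
  after-previous A≺B bag after = colorable-∅ λ p → no-out A≺B bag after (∩-left p) (∩-right p)

  Leads : VSet D → List (VSet D) → Set
  Leads A []      = ⊤
  Leads A (B ∷ L) = Precedes A B

  Chain : List (VSet D) → Set
  Chain []      = ⊤
  Chain (B ∷ L) = Bag B × Leads B L × Chain L

  -- Counting stops at the first bag that `v` is not after; in a chain, `after-previous` shows that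
  -- no later bag is missed.
  position : List (VSet D) → V → ℕ
  position []      v = 0
  position (B ∷ L) v with after? B v
  ... | yes _ = suc (position L v)
  ... | no _  = 0

  position-zero : ∀ {B L v} → position (B ∷ L) v ≡ 0 → ¬ After B v
  position-zero {B} {L} {v} eq with after? B v
  ... | no ¬after = ¬after

  position-suc : ∀ {B L v i} → position (B ∷ L) v ≡ suc i → After B v × position L v ≡ i
  position-suc {B} {L} {v} eq with after? B v
  position-suc refl | yes after = after , refl

  -- Let `B` be the first bag that `w` is not after. If `v` is after `B` and the next two bags `B₁`
  -- and `B₂`, then `B₁` sends no arc to `w` and receives none from `v`; all its remaining vertices
  -- are non-neighbours of `v` or `w` or complete v → w to a triangle, too few for a bag.
  position-≤ : ∀ L → Chain L → ∀ {v w} → arc D v w ≡ true → position L v ≤ position L w + 2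
  position-≤ []      _                   v→w = z≤n
  position-≤ (B ∷ L) (_ , leads , chain) {v} {w} v→w with after? B v | after? B w
  ... | no _  | _          = z≤n
  ... | yes _ | yes _      = s≤s (position-≤ L chain v→w)
  ... | yes _ | no ¬after-w = s≤s (at-most-one L leads chain)
    where
    at-most-one : ∀ L → Leads B L → Chain L → position L v ≤ 1
    at-most-one [] _ _ = z≤n
    at-most-one (B₁ ∷ L) B≺B₁ (bag , leads , chain) with after? B₁ v
    ... | no _ = z≤n
    at-most-one (B₁ ∷ []) B≺B₁ (bag , leads , chain) | yes _ = s≤s z≤n
    at-most-one (B₁ ∷ B₂ ∷ L) B≺B₁ (bag , B₁≺B₂ , bag₂ , _) | yes _ with after? B₂ v
    ... | no _ = s≤s z≤n
    ... | yes after-v = contradiction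
      (around v
        (around w
          (colorable-∅ λ p → no-in B≺B₁ ¬after-w (∩-left (∩-left p)) (∩-right p))
          (mono (λ p → ∩-intro (∩-right p) (∩-right (∩-left p))) (return-bound v→w)))
        (colorable-∅ λ p → no-out B₁≺B₂ bag₂ after-v (∩-left p) (∩-right p))) bag

  -- A member of a bag is after all earlier bags and not after the next one; its own bag may go
  -- either way.
  position-of-member : ∀ L → Chain L → ∀ i {v} → v ∈ lookup L i →
    position L v ≡ toℕ i ⊎ position L v ≡ suc (toℕ i)
  position-of-member (B ∷ L) (_ , leads , chain) zero {v} v∈B with after? B v
  ... | no _ = inj₁ refl
  position-of-member (B ∷ []) _ zero v∈B | yes _ = inj₂ refl
  position-of-member (B ∷ B₁ ∷ L) (_ , B≺B₁ , bag , _) zero {v} v∈B | yes _ with after? B₁ v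
  ... | no _ = inj₂ refl
  ... | yes after = contradiction after (bag-not-after bag (weaken (m≤n+m _ (suc h + c)) (proj₁ B≺B₁ v∈B)))
  position-of-member (B ∷ L) (_ , leads , chain) (suc i) {v} v∈ with after? B v
  ... | yes _ = [ inj₁ ∘ cong suc , inj₂ ∘ cong suc ]′ (position-of-member L chain i v∈)
  ... | no ¬after = contradiction (after-B L leads chain i v∈) ¬after
    where
    after-B : ∀ L → Leads B L → Chain L → ∀ i → v ∈ lookup L i → After B v
    after-B (B₁ ∷ L) B≺B₁ _ zero v∈ = weaken (m≤n+m _ (suc h + c)) (proj₂ B≺B₁ v∈)
    after-B (B₁ ∷ L) B≺B₁ chain@(bag , _) (suc i) v∈ with position-of-member (B₁ ∷ L) chain (suc i) v∈
    ... | inj₁ eq = after-previous B≺B₁ bag (proj₁ (position-suc {L = L} eq))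
    ... | inj₂ eq = after-previous B≺B₁ bag (proj₁ (position-suc {L = L} eq))

  -- One vertex is chosen from each bag of even index 2i. Its position is 2i or 2i + 1, so halving
  -- recovers `i` and the chosen vertices are distinct, one more than `D` has.
  chain-length : ∀ L → Chain L → ¬ suc (size D) + suc (size D) ≤ length L
  chain-length L chain long = ℕ.<-irrefl refl (injective⇒≤ member-inj)
    where
    index : Fin (suc (size D)) → Fin (length L)
    index i = fromℕ< (≤-trans (ℕ.+-mono-<-≤ (toℕ<n i) (ℕ.<⇒≤ (toℕ<n i))) long)

    bag : ∀ L → Chain L → ∀ i → Bag (lookup L i)
    bag (B ∷ L) (b , _)     zero    = b
    bag (B ∷ L) (_ , _ , c) (suc i) = bag L c i

    member : ∀ i → ∃ λ v → v ∈ lookup L (index i)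
    member i = nonempty (bag L chain (index i))

    half : ∀ i → ⌊ position L (proj₁ (member i)) /2⌋ ≡ toℕ i
    half i with position-of-member L chain (index i) (proj₂ (member i))
    ... | inj₁ eq = trans (cong ⌊_/2⌋ (trans eq (toℕ-fromℕ< _))) (sym (ℕ.n≡⌊n+n/2⌋ (toℕ i)))
    ... | inj₂ eq = trans (cong ⌊_/2⌋ (trans eq (cong suc (toℕ-fromℕ< _)))) (sym (ℕ.n≡⌈n+n/2⌉ (toℕ i)))

    member-inj : Injective _≡_ _≡_ (proj₁ ∘ member)
    member-inj {i} {j} eq =
      toℕ-injective (trans (sym (half i)) (trans (cong (λ v → ⌊ position L v /2⌋) eq) (half j)))

  middle : ∀ S p → ¬ Colorable D S (split p) →
    ∃ λ v → v ∈ S × ¬ Colorable D (S ∩ In D v) p × ¬ Colorable D (S ∩ Out D v) p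
  middle S p big with any? (λ v → (v ∈? S)
    ×-dec ¬? (colorable? (S ∩ In D v) p) ×-dec ¬? (colorable? (S ∩ Out D v) p))
  ... | yes found = found
  ... | no none   = contradiction (local-colocal D local-bound colocal-bound
    λ v∈S out-big in-big → none (_ , v∈S , in-big , out-big)) big

  record Refinement (Y : VSet D) : Set where
    field
      {X₁ X₂ X₃}     : VSet D
      X₁⊆ : X₁ ⊆ Y
      X₃⊆ : X₃ ⊆ Y
      bag₁ : Bag X₁
      bag₂ : Bag X₂
      bag₃ : Bag X₃
      X₁≺X₂ : Precedes X₁ X₂
      X₂≺X₃ : Precedes X₂ X₃

  -- The first bag consists of the in-neighbours of `v` in `Y`; the out-neighbours of `v` are
  -- divided again by `w` into the second and third.
  refine : ∀ Y → ¬ Colorable D Y level-bound → Refinement Y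
  refine Y big with middle Y (large + split large) big
  ... | v , _ , in-big , out-big with middle (Y ∩ Out D v) large (out-big ∘ weaken (m≤n+m _ large))
  ... | w , _ , in-big′ , out-big′ = record
    { X₁⊆   = ∩-left
    ; X₃⊆   = ∩-left ∘ ∩-left
    ; bag₁  = in-big ∘ weaken (m≤m+n large _)
    ; bag₂  = in-big′
    ; bag₃  = out-big′
    ; X₁≺X₂ = precedes-via ∩-right (∩-right ∘ ∩-left)
    ; X₂≺X₃ = precedes-via ∩-right ∩-right
    }

  module Extend {Y : VSet D} (R : Refinement Y) where

    open Refinement R

    -- For `Y` at position `i`, the bags with indices i - 1 and i give way to the refinement. Being
    -- after bag i - 1, `Y` sends no arcs to bag i - 2; not being after bag i, it receives none from
    -- bag i + 1.
    extend : ℕ → List (VSet D) → List (VSet D)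
    extend zero          L       = X₁ ∷ X₂ ∷ X₃ ∷ drop 1 L
    extend (suc zero)    L       = extend zero (drop 1 L)
    extend (suc (suc i)) []      = []
    extend (suc (suc i)) (B ∷ L) = B ∷ extend (suc i) L

    -- This vertex rules out a positive common position on the empty chain.
    y₀ : ∃ λ y → y ∈ Y
    y₀ = let x , x∈ = nonempty bag₁ in x , X₁⊆ x∈

    AllAt : ℕ → List (VSet D) → Set
    AllAt i L = ∀ {y} → y ∈ Y → position L y ≡ i

    all-after : ∀ {B L i} → AllAt (suc i) (B ∷ L) → ∀ {y} → y ∈ Y → After B y
    all-after {L = L} at y∈Y = proj₁ (position-suc {L = L} (at y∈Y))

    all-next : ∀ {B L i} → AllAt (suc i) (B ∷ L) → AllAt i L
    all-next {L = L} at y∈Y = proj₂ (position-suc {L = L} (at y∈Y))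

    extend-zero : ∀ L → Chain L → AllAt 0 L → Chain (extend 0 L)
    extend-zero L chain at = bag₁ , X₁≺X₂ , bag₂ , X₂≺X₃ , bag₃ , leads₃ L chain at , rest L chain
      where
      leads₃ : ∀ L → Chain L → AllAt 0 L → Leads X₃ (drop 1 L)
      leads₃ []           _             at = tt
      leads₃ (B ∷ [])     _             at = tt
      leads₃ (B ∷ B₁ ∷ L) (_ , B≺B₁ , _) at = precedes-complete λ x∈X₃ →
        no-in B≺B₁ (position-zero {L = B₁ ∷ L} (at (X₃⊆ x∈X₃)))

      rest : ∀ L → Chain L → Chain (drop 1 L)
      rest []      _             = tt
      rest (B ∷ L) (_ , _ , chain) = chain

    extend-chain : ∀ i L → Chain L → AllAt i L → Chain (extend i L)
    extend-chain zero L chain at = extend-zero L chain at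
    extend-chain (suc zero) [] chain at with () ← at (proj₂ y₀)
    extend-chain (suc zero) (B ∷ L) (_ , _ , chain) at = extend-zero L chain (all-next {L = L} at)
    extend-chain (suc (suc i)) [] chain at = tt
    extend-chain (suc (suc i)) (B ∷ L) (bag , leads , chain) at =
      bag , leads′ i L leads chain (all-next {L = L} at) , extend-chain (suc i) L chain (all-next {L = L} at)
      where
      leads′ : ∀ i L → Leads B L → Chain L → AllAt (suc i) L → Leads B (extend (suc i) L)
      leads′ i [] _ _ at with () ← at (proj₂ y₀)
      leads′ zero (B₁ ∷ L) B≺B₁ (bag , _) at = precedes-complete λ a∈B x∈X₁ x→a →
        no-out B≺B₁ bag (all-after {L = L} at (X₁⊆ x∈X₁)) a∈B (mem (holds x→a))
      leads′ (suc i) (B₁ ∷ L) B≺B₁ _ at = B≺B₁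

    extend-length : ∀ i L → AllAt i L → suc (length L) ≤ length (extend i L)
    extend-length zero          []      at = s≤s z≤n
    extend-length zero          (B ∷ L) at = ℕ.n≤1+n _
    extend-length (suc i)       []      at with () ← at (proj₂ y₀)
    extend-length (suc zero)    (B ∷ []) at = s≤s (s≤s z≤n)
    extend-length (suc zero)    (B ∷ B₁ ∷ L) at = ≤-refl
    extend-length (suc (suc i)) (B ∷ L) at = s≤s (extend-length (suc i) L (all-next {L = L} at))

  Level : List (VSet D) → ℕ → VSet D
  Level L i = ⟦ (λ v → position L v ℕ.≟ i) ⟧

  bounded-by-levels : ∀ L → Chain L → (∀ i → Colorable D (Level L i) level-bound) →
    Colorable D (full D) bound
  bounded-by-levels L chain level =
    cover ∖-split (cover others (part (suc zero)) (part (suc (suc zero)))) (mono ∩-right (part zero))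
    where
    part? : ∀ a v → Dec (residue (position L v) ≡ a)
    part? a v = residue (position L v) ≟ a

    part : ∀ a → Colorable D ⟦ part? a ⟧ level-bound
    part a = levels (position L)
      (λ u∈ v∈ u→v → residue-gap _ _ (position-≤ L chain u→v)
        (trans (⟦⟧-elim (part? a) u∈) (sym (⟦⟧-elim (part? a) v∈))))
      (λ i → mono ∩-right (level i))

    others : ∀ {v} → v ∈ full D ∖ ⟦ part? zero ⟧ → v ∈ ⟦ part? (suc zero) ⟧ ⊎ v ∈ ⟦ part? (suc (suc zero)) ⟧
    others {v} p with residue (position L v) in eq
    ... | zero             = contradiction (⟦⟧-intro (part? zero) eq) (proj₂ (∖-elim p))
    ... | suc zero         = inj₁ (⟦⟧-intro (part? (suc zero)) eq)
    ... | suc (suc zero)   = inj₂ (⟦⟧-intro (part? (suc (suc zero))) eq)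

  -- If no longer chain exists, every level is bounded, since a large one could be refined; then all
  -- of `D` is bounded.
  long-chains : ¬ Colorable D (full D) bound → ∀ t → ¬ ¬ Σ (List (VSet D)) λ L → Chain L × t ≤ length L
  long-chains big zero    k = k ([] , tt , z≤n)
  long-chains big (suc t) k = long-chains big t λ (L , chain , t≤) →
    big (bounded-by-levels L chain λ i → decidable-stable (colorable? (Level L i) level-bound) λ level-big →
      let open Extend (refine (Level L i) level-big)
          at = λ {y} → ⟦⟧-elim (λ v → position L v ℕ.≟ i) {y}
      in k (extend i L , extend-chain i L chain at , ≤-trans (s≤s t≤) (extend-length i L at)))

  full-bound : Colorable D (full D) bound
  full-bound = decidable-stable (colorable? (full D) bound) λ big →
    long-chains big (suc (size D) + suc (size D)) λ (L , chain , long) → chain-length L chain long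

-- Passing from r K₁ + F to (r + 1) K₁ + F

full-dichrom : ∀ {D c} → Colorable D (full D) c → DichromLE D c
full-dichrom {D} (coloring (col , ok)) = col , λ j →
  acyclic-mono D (λ v → ⊤ × col v ≡ j) (Coloured {D} (full D) col j) (λ (_ , eq) → mem refl , eq) (ok j)

-- A `K₁`-free digraph has no vertices, so zero colours suffice.
K₁-hero : ∀ C → HeroIn C K₁
K₁-hero C = 0 , λ D _ K₁-free → (λ v → ⊥-elim (K₁-free (K₁-embeds D v))) , λ ()

module AddVertex (F : Digraph) (r : ℕ) where

  private
    smaller larger : Digraph
    smaller = r · K₁ +D F
    larger  = suc r · K₁ +D F

  hero-smaller : ∀ {H} → HeroFree larger H → HeroFree smaller H
  hero-smaller (c , bound) = c , λ D smaller-free →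
    bound D λ e → smaller-free (Embeds-trans {smaller} {larger} {D} (drop-K₁ F r) e)

  -- A copy of `smaller` among the non-neighbours other than `v` would form `larger` together with
  -- `v`; the final colour is for `v`.
  non-bound : ∀ {H} (hero : HeroFree smaller H) {D} → Free larger D → Free H D →
    ∀ v → Colorable D (Non D v) (suc (proj₁ hero) + 1)
  non-bound {H} hero {D} larger-free H-free v =
    cover ∖-split
      (hero-bound D (Non D v ∖ ⟦ _≟ v ⟧) {H} {Free smaller} hero
        (λ e → larger-free (add-K₁ F r D v (embedsIn D _ {smaller} e))) (H-free ∘ proj₁))
      (mono ∩-right (colorable-singleton D v))

  ⇒-hero : ∀ H₁ H₂ → HeroFree larger H₁ → HeroFree larger H₂ →
    HeroFree smaller (H₁ ⇒ H₂) → HeroFree larger (H₁ ⇒ H₂)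
  ⇒-hero H₁ H₂ hero₁ hero₂ hero = JoinBounds.bound (size H₁) (size H₂) (suc (proj₁ hero) + 1) h ,
    λ D larger-free ⇒-free → full-dichrom (Join.full-bound {D} {H₁} {H₂}
      (non-bound {H₁ ⇒ H₂} hero larger-free ⇒-free)
      (λ S H₁-free → weaken (m≤m+n _ _)
        (hero-bound D S {H₁} {Free larger} hero₁ (restrict-free D S {larger} larger-free) H₁-free))
      (λ S H₂-free → weaken (m≤n+m _ (suc (proj₁ hero₁)))
        (hero-bound D S {H₂} {Free larger} hero₂ (restrict-free D S {larger} larger-free) H₂-free))
      ⇒-free)
    where
    h : ℕ
    h = suc (proj₁ hero₁) + suc (proj₁ hero₂)

  Δ11-hero : ∀ H → HeroFree larger H → HeroFree smaller (Δ11 H) →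
    (∀ k → 1 ≤ k → HeroIn (λ D → Local k D × Free larger D) (Δ11 H)) →
    (∀ k → 1 ≤ k → HeroIn (λ D → Colocal k D × Free larger D) (Δ11 H)) →
    HeroFree larger (Δ11 H)
  Δ11-hero H hero Δ-hero local-hero colocal-hero =
    ChainBounds.bound (suc (proj₁ Δ-hero) + 1) (proj₁ hero) (suc ∘ proj₁ ∘ local) (suc ∘ proj₁ ∘ colocal) ,
    λ D larger-free Δ-free → full-dichrom (Chains.full-bound {D}
      {local-χ = suc ∘ proj₁ ∘ local} {colocal-χ = suc ∘ proj₁ ∘ colocal}
      (non-bound {Δ11 H} Δ-hero larger-free Δ-free)
      (λ {u} {v} u→v → hero-bound D (Return D u v) {H} {Free larger} hero
        (restrict-free D _ {larger} larger-free) (Δ-free ∘ Δ11-embeds {H} D u→v))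
      (λ {S} {p} locals → hero-bound D S {Δ11 H} {λ D → Local (suc p) D × Free larger D} (local p)
        (restrict-local D S (weaken (ℕ.n≤1+n p) ∘ locals)
        , restrict-free D S {larger} larger-free) (Δ-free ∘ proj₁))
      (λ {S} {p} colocals → hero-bound D S {Δ11 H} {λ D → Colocal (suc p) D × Free larger D} (colocal p)
        (restrict-colocal D S (weaken (ℕ.n≤1+n p) ∘ colocals)
        , restrict-free D S {larger} larger-free) (Δ-free ∘ proj₁)))
    where
    -- The shift to `suc p` meets the requirement 1 ≤ k of the localized property.
    local : ∀ p → HeroIn (λ D → Local (suc p) D × Free larger D) (Δ11 H)
    local p = local-hero (suc p) (s≤s z≤n)

    colocal : ∀ p → HeroIn (λ D → Colocal (suc p) D × Free larger D) (Δ11 H)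
    colocal p = colocal-hero (suc p) (s≤s z≤n)

theorem3p2 : (F : Digraph) → Localized F → Colocalized F → Cooperates F →
    ∀ (r : ℕ) → Cooperates (r · K₁ +D F)
-- `0 · K₁ +D F` is definitionally `F`, as `splitAt 0` reduces to `inj₂`.
theorem3p2 F localized colocalized cooperates zero = cooperates
theorem3p2 F localized colocalized cooperates (suc r)
  with theorem3p2 F localized colocalized cooperates r
... | _ , ⇒-smaller , Δ11-smaller =
  K₁-hero _
  , (λ H₁ H₂ hero₁ hero₂ → ⇒-hero H₁ H₂ hero₁ hero₂
      (⇒-smaller H₁ H₂ (hero-smaller {H₁} hero₁) (hero-smaller {H₂} hero₂)))
  , λ H hero → let Δ-hero = Δ11-smaller H (hero-smaller {H} hero) in
      Δ11-hero H hero Δ-hero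
        (localized (suc r) (s≤s z≤n) H Δ-hero hero) (colocalized (suc r) (s≤s z≤n) H Δ-hero hero)
  where open AddVertex F r
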